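{- Let $p>r\geq 2$ be integers, and define the multisets $$A=\{\pm(pr-1),\pm(p+r)\},\qquad B=\{\pm(pr+1),\pm(p-r)\}.$$ Then $A$ and $B$ form a nontrivial degree-three Prouhet--Tarry--Escott solution.
   Context: The notation $\{\pm x,\pm y\}$ means the four-element multiset $\{x,-x,y,-y\}$. Two four-element multisets of integers $A,B$ form a degree-three Prouhet--Tarry--Escott solution if $\sum_{a\in A}a^\ell=\sum_{b\in B}b^\ell$ for $\ell=1,2,3$ (with multiplicity); the solution is nontrivial if $A\neq B$ as multisets. -}

module Defs where

open import Data.Integer using (ℤ; 0ℤ; _+_; -_; _^_)
open import Data.List using (foldr; map)
open import Data.List.Relation.Binary.Permutation.Propositional using (_↭_)
open import Data.Nat using (ℕ; _≤_)
open import Data.Product using (_×_)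
open import Data.Vec using (Vec; []; _∷_; toList)
open import Relation.Binary.PropositionalEquality using (_≡_)
open import Relation.Nullary using (¬_)

-- A four-element multiset is represented by an enumeration of its elements
-- with multiplicity; two enumerations denote the same multiset when one is a
-- permutation of the other (_≈ᴹ_).
Multiset₄ : Set
Multiset₄ = Vec ℤ 4

infix 4 _≈ᴹ_

_≈ᴹ_ : Multiset₄ → Multiset₄ → Set
A ≈ᴹ B = toList A ↭ toList B

⟅±_,±_⟆ : ℤ → ℤ → Multiset₄
⟅± x ,± y ⟆ = x ∷ - x ∷ y ∷ - y ∷ []

powerSum : ℕ → Multiset₄ → ℤ
powerSum ℓ A = foldr _+_ 0ℤ (map (_^ ℓ) (toList A))

IsDegreeThreePTE : Multiset₄ → Multiset₄ → Set
IsDegreeThreePTE A B = ∀ ℓ → 1 ≤ ℓ → ℓ ≤ 3 → powerSum ℓ A ≡ powerSum ℓ B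

IsNontrivialDegreeThreePTE : Multiset₄ → Multiset₄ → Set
IsNontrivialDegreeThreePTE A B = IsDegreeThreePTE A B × ¬ (A ≈ᴹ B)

{-# OPTIONS --safe #-}
module Submission where

open import Defs
open import Data.Integer using (ℤ; +_; 0ℤ; 1ℤ; -1ℤ; _+_; _-_; _*_; -_; _≤_; _<_; +≤+; -≤+)
open import Data.Integer.Properties
  using (≤-refl; ≤-trans; <⇒≤; <⇒≱; ≤-<-trans; suc[i]≤j⇒i<j; i≡j⇒i-j≡0; i-j≡0⇒i≡j; ≤-reflexive; i*j≡0⇒i≡0∨j≡0)
open import Data.Integer.Tactic.RingSolver using (solve-∀)
open import Data.List.Membership.Propositional using (_∈_)
open import Data.List.Relation.Binary.Permutation.Propositional using (↭-sym)
open import Data.List.Relation.Binary.Permutation.Propositional.Properties using (∈-resp-↭)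
open import Data.List.Relation.Unary.Any using (here; there)
open import Data.Nat using (suc; z≤n; s≤s)
open import Data.Product using (_,_)
open import Data.Sum using ([_,_])
open import Data.Vec using (toList)
open import Function using (case_of_)
open import Relation.Binary.PropositionalEquality using (_≡_; _≢_; refl; sym; trans; cong)
open import Relation.Nullary using (¬_)

-- p r + 1 occurs in B but not in A: its differences with the elements of A
-- are 2, 2 p r, (p - 1)(r - 1) and (p + 1)(r + 1), none of which vanishes.

-- Odd power sums of a multiset closed under negation cancel, so only degree two has content. There
-- the sums of squares are the norms of (p + i)(r + i) = (pr - 1) + (p + r)i and (p + i)(r - i) =
-- (pr + 1) - (p - r)i, which agree since conjugating a factor preserves the norm. For
-- nontriviality, a permutation would carry `p * r + 1ℤ` from B into A, which `pr+1∉A` excludes.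

powerSum-1 : ∀ x y → powerSum 1 ⟅± x ,± y ⟆ ≡ 0ℤ
-- At a literal exponent `powerSum` computes to the polynomial in `identity`, the form the ring
-- solver can read.
powerSum-1 = identity
  where
  identity : ∀ x y → x * 1ℤ + (- x * 1ℤ + (y * 1ℤ + (- y * 1ℤ + 0ℤ))) ≡ 0ℤ
  identity = solve-∀

powerSum-2 : ∀ x y → powerSum 2 ⟅± x ,± y ⟆ ≡ + 2 * (x * x + y * y)
powerSum-2 = identity
  where
  identity : ∀ x y →
    x * (x * 1ℤ) + (- x * (- x * 1ℤ) + (y * (y * 1ℤ) + (- y * (- y * 1ℤ) + 0ℤ)))
      ≡ + 2 * (x * x + y * y)
  identity = solve-∀

powerSum-3 : ∀ x y → powerSum 3 ⟅± x ,± y ⟆ ≡ 0ℤ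
powerSum-3 = identity
  where
  identity : ∀ x y →
    x * (x * (x * 1ℤ)) + (- x * (- x * (- x * 1ℤ))
      + (y * (y * (y * 1ℤ)) + (- y * (- y * (- y * 1ℤ)) + 0ℤ))) ≡ 0ℤ
  identity = solve-∀

-- Both sides equal (p² + 1)(r² + 1).
sum-of-squares : ∀ p r →
  (p * r - 1ℤ) * (p * r - 1ℤ) + (p + r) * (p + r)
    ≡ (p * r + 1ℤ) * (p * r + 1ℤ) + (p - r) * (p - r)
sum-of-squares = solve-∀

isDegreeThreePTE : ∀ p r → IsDegreeThreePTE
  ⟅± (p * r - 1ℤ) ,± (p + r) ⟆
  ⟅± (p * r + 1ℤ) ,± (p - r) ⟆
isDegreeThreePTE p r 1 _ _ =
  trans (powerSum-1 (p * r - 1ℤ) (p + r)) (sym (powerSum-1 (p * r + 1ℤ) (p - r)))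
isDegreeThreePTE p r 2 _ _ =
  trans (powerSum-2 (p * r - 1ℤ) (p + r))
    (trans (cong (+ 2 *_) (sum-of-squares p r)) (sym (powerSum-2 (p * r + 1ℤ) (p - r))))
isDegreeThreePTE p r 3 _ _ =
  trans (powerSum-3 (p * r - 1ℤ) (p + r)) (sym (powerSum-3 (p * r + 1ℤ) (p - r)))
isDegreeThreePTE p r (suc (suc (suc (suc _)))) _ (s≤s (s≤s (s≤s ())))

i-k≢0 : ∀ {i k} → k < i → i - k ≢ 0ℤ
i-k≢0 {i} {k} k<i i-k≡0 = <⇒≱ k<i (≤-reflexive (i-j≡0⇒i≡j i k i-k≡0))

-- ℤ has no zero divisors. Taking `k` to be 0, 1 and -1 covers the three differences from A that
-- depend on p and r.
[i-k][j-k]≢0 : ∀ {i j k} → k < i → k < j → (i - k) * (j - k) ≢ 0ℤ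
[i-k][j-k]≢0 {i} {j} {k} k<i k<j eq =
  [ i-k≢0 k<i , i-k≢0 k<j ] (i*j≡0⇒i≡0∨j≡0 (i - k) eq)

pr+1∉A : ∀ p r → 1ℤ < p → 1ℤ < r →
  ¬ (p * r + 1ℤ ∈ toList ⟅± (p * r - 1ℤ) ,± (p + r) ⟆)
pr+1∉A p r 1<p 1<r = λ where
    (here eq) → case trans (diff₁ p r) (i≡j⇒i-j≡0 eq) of λ ()
    (there (here eq)) →
      [ (λ ()) , nonzero (+≤+ z≤n) ]
        (i*j≡0⇒i≡0∨j≡0 (+ 2) (trans (diff₂ p r) (i≡j⇒i-j≡0 eq)))
    (there (there (here eq))) →
      nonzero ≤-refl (trans (diff₃ p r) (i≡j⇒i-j≡0 eq))
    (there (there (there (here eq)))) →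
      nonzero -≤+ (trans (diff₄ p r) (i≡j⇒i-j≡0 eq))
  where
  -- The extreme case `k` = 1 is where r ≥ 2 matters: r = 1 would give pr + 1 = p + r.
  nonzero : ∀ {k} → k ≤ 1ℤ → (p - k) * (r - k) ≢ 0ℤ
  nonzero k≤1 = [i-k][j-k]≢0 (≤-<-trans k≤1 1<p) (≤-<-trans k≤1 1<r)

  diff₁ : ∀ p r → + 2 ≡ (p * r + 1ℤ) - (p * r - 1ℤ)
  diff₁ = solve-∀

  -- The subtractions of `0ℤ` make the product an instance of `nonzero` at `k` = 0.
  diff₂ : ∀ p r → + 2 * ((p - 0ℤ) * (r - 0ℤ)) ≡ (p * r + 1ℤ) - - (p * r - 1ℤ)
  diff₂ = solve-∀

  diff₃ : ∀ p r → (p - 1ℤ) * (r - 1ℤ) ≡ (p * r + 1ℤ) - (p + r)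
  diff₃ = solve-∀

  diff₄ : ∀ p r → (p - -1ℤ) * (r - -1ℤ) ≡ (p * r + 1ℤ) - - (p + r)
  diff₄ = solve-∀

proposition3p1 : (p r : ℤ) → r < p → + 2 ≤ r →
    IsNontrivialDegreeThreePTE
    ⟅± (p * r - 1ℤ) ,± (p + r) ⟆
    ⟅± (p * r + 1ℤ) ,± (p - r) ⟆
proposition3p1 p r r<p 2≤r =
    isDegreeThreePTE p r
  -- p > 1 follows from 2 ≤ r < p, with `+ 2` read as the successor of `1ℤ`; `here refl` works
  -- because pr + 1 heads the enumeration of B.
  , λ A≈B → pr+1∉A p r (suc[i]≤j⇒i<j (≤-trans 2≤r (<⇒≤ r<p))) (suc[i]≤j⇒i<j 2≤r)
      (∈-resp-↭ (↭-sym A≈B) (here refl))
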